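{- Let $\mathbb{A}$ be the algebraic closure of a field $\mathbb{F}$, let $f_1,\dots,f_m\in\mathbb{F}[x_1,\dots,x_n]$, and let $f:\mathbb{A}^n\to\mathbb{A}^m$ be the polynomial map $x\mapsto(f_1(x),\dots,f_m(x))$, with image $\mathrm{Im}(f)=f(\mathbb{A}^n)$. Then the constant term of every annihilator $Q\in\mathbb{A}[Y_1,\dots,Y_m]$ of $f_1,\dots,f_m$ is zero if and only if the origin $O=(0,\dots,0)\in\mathbb{A}^m$ lies in $\overline{\mathrm{Im}(f)}$.
   Context: An annihilator of $f_1,\dots,f_m$ is a polynomial $Q$ with $Q(f_1,\dots,f_m)=0$. For $S\subseteq\mathbb{A}^m$, $\overline{S}$ denotes its Zariski closure in $\mathbb{A}^m$. -}

module Defs where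

open import Algebra.Apartness.Bundles using (HeytingField; HeytingCommutativeRing)
open import Algebra.Bundles using (CommutativeRing)
open import Algebra.Bundles.Raw using (RawRing)
open import Algebra.Morphism.Structures using (module RingMorphisms)
open import Data.List.Base using (List; []; _∷_; map; foldr)
open import Data.Nat.Base using (ℕ; zero; suc)
open import Data.Product.Base using (∃-syntax; _×_)
open import Data.Vec.Base as Vec using (Vec; []; _∷_)
open import Data.Vec.Relation.Binary.Pointwise.Inductive using (Pointwise)
open import Level using (Level; _⊔_) renaming (suc to lsuc)
open import Relation.Unary using (Pred; _∈_; _⊆_; _≐_)

private
  variable
    c c₁ c₂ ℓ ℓ₁ ℓ₂ ℓ₃ ℓ₄ s : Level

-- Fields are the library's Heyting fields.  Tightness makes x # y classically
-- the same as ¬ (x ≈ y), so classically these are exactly the usual fields.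

rawRing : HeytingField c ℓ₁ ℓ₂ → RawRing c ℓ₁
rawRing K = CommutativeRing.rawRing
  (HeytingCommutativeRing.commutativeRing (HeytingField.heytingCommutativeRing K))

-- A polynomial in one variable is its list of coefficients, lowest degree
-- first.  Trailing zeros are allowed; equality is equality of all coefficients.

module _ (R : RawRing c ℓ) where
  open RawRing R

  coeff : List Carrier → ℕ → Carrier
  coeff []       _       = 0#
  coeff (a ∷ p)  zero    = a
  coeff (a ∷ p)  (suc i) = coeff p i

  addCoeffs : List Carrier → List Carrier → List Carrier
  addCoeffs []      q       = q
  addCoeffs (a ∷ p) []      = a ∷ p
  addCoeffs (a ∷ p) (b ∷ q) = (a + b) ∷ addCoeffs p q

  mulCoeffs : List Carrier → List Carrier → List Carrier
  mulCoeffs []      q = []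
  mulCoeffs (a ∷ p) q = addCoeffs (map (a *_) q) (0# ∷ mulCoeffs p q)

  _[X] : RawRing c ℓ
  _[X] = record
    { Carrier = List Carrier
    ; _≈_     = λ p q → ∀ i → coeff p i ≈ coeff q i
    ; _+_     = addCoeffs
    ; _*_     = mulCoeffs
    ; -_      = map -_
    ; 0#      = []
    ; 1#      = 1# ∷ []
    }

-- R[X₁,…,Xₙ] as an iterated polynomial ring, X₁ being the outermost variable.

_[X^_] : RawRing c ℓ → ℕ → RawRing c ℓ
R [X^ zero  ] = R
R [X^ suc n ] = (R [X^ n ]) [X]

Polynomial : RawRing c ℓ → ℕ → Set c
Polynomial R n = RawRing.Carrier (R [X^ n ])

constant : (R : RawRing c ℓ) (n : ℕ) → RawRing.Carrier R → Polynomial R n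
constant R zero    a = a
constant R (suc n) a = constant R n a ∷ []

constantTerm : (R : RawRing c ℓ) (n : ℕ) → Polynomial R n → RawRing.Carrier R
constantTerm R zero    p = p
constantTerm R (suc n) p = constantTerm R n (coeff (R [X^ n ]) p 0)

mapCoefficients : (R : RawRing c₁ ℓ₁) (S : RawRing c₂ ℓ₂) →
                  (RawRing.Carrier R → RawRing.Carrier S) →
                  (n : ℕ) → Polynomial R n → Polynomial S n
mapCoefficients R S φ zero    = φ
mapCoefficients R S φ (suc n) = map (mapCoefficients R S φ n)

-- The value of a polynomial over R at a tuple of elements of S, with the
-- coefficients sent to S by φ.

evaluate : (R : RawRing c₁ ℓ₁) (S : RawRing c₂ ℓ₂) →
           (RawRing.Carrier R → RawRing.Carrier S) →
           {n : ℕ} → Vec (RawRing.Carrier S) n → Polynomial R n → RawRing.Carrier S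
evaluate R S φ []       = φ
evaluate R S φ (x ∷ xs) = foldr (λ a v → evaluate R S φ xs a + x * v) 0#
  where open RawRing S

module _ (K : HeytingField c ℓ₁ ℓ₂) where
  open HeytingField K

  IsNonzero : Polynomial (rawRing K) 1 → Set ℓ₂
  IsNonzero p = ∃[ i ] coeff (rawRing K) p i # 0#

  IsNonconstant : Polynomial (rawRing K) 1 → Set ℓ₂
  IsNonconstant p = ∃[ i ] coeff (rawRing K) p (suc i) # 0#

  IsAlgebraicallyClosed : Set (c ⊔ ℓ₁ ⊔ ℓ₂)
  IsAlgebraicallyClosed =
    ∀ (p : Polynomial (rawRing K) 1) → IsNonconstant p →
    ∃[ x ] evaluate (rawRing K) (rawRing K) (λ a → a) (x ∷ []) p ≈ 0#

record IsAlgebraicClosure (F : HeytingField c₁ ℓ₁ ℓ₂) (A : HeytingField c₂ ℓ₃ ℓ₄)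
                          (ι : HeytingField.Carrier F → HeytingField.Carrier A)
                          : Set (c₁ ⊔ ℓ₁ ⊔ ℓ₂ ⊔ c₂ ⊔ ℓ₃ ⊔ ℓ₄) where
  open HeytingField A using (_≈_; 0#)
  open RingMorphisms (rawRing F) (rawRing A) using (IsRingHomomorphism)
  field
    isRingHomomorphism    : IsRingHomomorphism ι
    isAlgebraic           : ∀ a → ∃[ p ] IsNonzero F p ×
                              evaluate (rawRing F) (rawRing A) ι (a ∷ []) p ≈ 0#
    isAlgebraicallyClosed : IsAlgebraicallyClosed A

module AffineSpace (A : HeytingField c ℓ₁ ℓ₂) where
  open HeytingField A

  𝔸^_ : ℕ → Set c
  𝔸^ m = Vec Carrier m

  origin : (m : ℕ) → 𝔸^ m
  origin m = Vec.replicate m 0#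

  value : {m : ℕ} → Polynomial (rawRing A) m → 𝔸^ m → Carrier
  value Q y = evaluate (rawRing A) (rawRing A) (λ a → a) y Q

  VanishingSet : {m : ℕ} → Pred (Polynomial (rawRing A) m) s → Pred (𝔸^ m) (c ⊔ ℓ₁ ⊔ s)
  VanishingSet I y = ∀ Q → Q ∈ I → value Q y ≈ 0#

  IsZariskiClosed : {m : ℕ} → Pred (𝔸^ m) (c ⊔ ℓ₁) → Set (lsuc (c ⊔ ℓ₁))
  IsZariskiClosed {m} Z =
    ∃[ I ] Z ≐ VanishingSet {s = c ⊔ ℓ₁} {m = m} I

  -- The intersection of all Zariski closed sets containing S.  The universe
  -- level of Z is no restriction: it accommodates the zero set of any single
  -- polynomial, and every zero set is an intersection of those.

  ZariskiClosure : {m : ℕ} → Pred (𝔸^ m) s → Pred (𝔸^ m) (s ⊔ lsuc (c ⊔ ℓ₁))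
  ZariskiClosure S y = ∀ Z → IsZariskiClosed Z → S ⊆ Z → y ∈ Z

module PolynomialMap (F : HeytingField c₁ ℓ₁ ℓ₂) (A : HeytingField c₂ ℓ₃ ℓ₄)
                     (ι : HeytingField.Carrier F → HeytingField.Carrier A)
                     (n m : ℕ) (f : Vec (Polynomial (rawRing F) n) m) where
  open HeytingField A using (_≈_)
  open AffineSpace A

  polynomialMap : 𝔸^ n → 𝔸^ m
  polynomialMap x = Vec.map (evaluate (rawRing F) (rawRing A) ι x) f

  Image : Pred (𝔸^ m) (c₂ ⊔ ℓ₃)
  Image y = ∃[ x ] Pointwise _≈_ (polynomialMap x) y

  -- Q(f₁,…,fₘ) = 0 is an equation in A[X₁,…,Xₙ], not between functions on 𝔸ⁿ.

  IsAnnihilator : Polynomial (rawRing A) m → Set ℓ₃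
  IsAnnihilator Q =
    evaluate (rawRing A) A[X] (constant (rawRing A) n)
      (Vec.map (mapCoefficients (rawRing F) (rawRing A) ι n) f) Q
      A[X].≈ A[X].0#
    where
    A[X] = rawRing A [X^ n ]
    module A[X] = RawRing A[X]

{-# OPTIONS --safe #-}

-- Q annihilates f₁,…,fₘ iff Q vanishes on Im(f), because a polynomial over an
-- algebraically closed field which vanishes everywhere has zero coefficients.
-- For one variable this needs no count of roots: if p had a nonzero coefficient
-- in positive degree then p + 1 would have a root, where p takes the value −1.
-- The closed set cut out by such a Q contains Im(f), and Q(O) is its constant term.

module Submission where

open import Defs
open import Algebra.Apartness.Bundles using (HeytingField; HeytingCommutativeRing)
open import Algebra.Bundles using (CommutativeRing)
open import Algebra.Bundles.Raw using (RawRing; RawSemiring)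
import Algebra.Morphism.Construct.Identity as Identity
open import Algebra.Morphism.Structures using (module NearSemiringMorphisms)
import Algebra.Properties.CommutativeSemigroup as CommutativeSemigroupProperties
open import Data.List.Base using (List; []; _∷_; map; foldr)
open import Data.List.Properties using (foldr-map; foldr-cong)
open import Data.Nat.Base using (ℕ; zero; suc)
open import Data.Product.Base using (_,_; proj₁)
open import Data.Vec.Base as Vec using (Vec; []; _∷_)
open import Data.Vec.Properties using (map-∘; map-cong)
open import Data.Vec.Relation.Binary.Pointwise.Inductive as Pointwise using (Pointwise; []; _∷_)
open import Function.Base using (id; _∘_)
open import Function.Bundles using (_⇔_; mk⇔)
open import Level using (Level; Lift; lift; _⊔_)
open import Relation.Binary.PropositionalEquality.Core as ≡ using (_≡_; _≗_)
import Relation.Binary.Reasoning.Setoid as SetoidReasoning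
open import Relation.Unary using (Pred; _∈_)

private
  variable
    c c₁ c₂ ℓ ℓ₁ ℓ₂ : Level

-- Change of coefficients.

commutativeRing : HeytingField c ℓ₁ ℓ₂ → CommutativeRing c ℓ₁
commutativeRing K = HeytingCommutativeRing.commutativeRing (HeytingField.heytingCommutativeRing K)

-- Reconciles two readings of f: annihilators substitute the polynomials with coefficients already
-- sent to A, while the polynomial map sends the coefficients during evaluation.
evaluate-mapCoefficients :
  (R : RawRing c ℓ) (S : RawRing c₁ ℓ₁) (T : RawRing c₂ ℓ₂)
  (φ : RawRing.Carrier R → RawRing.Carrier S) (χ : RawRing.Carrier S → RawRing.Carrier T)
  {n : ℕ} (xs : Vec (RawRing.Carrier T) n) →
  evaluate S T χ xs ∘ mapCoefficients R S φ n ≗ evaluate R T (χ ∘ φ) xs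
evaluate-mapCoefficients R S T φ χ []       p = ≡.refl
evaluate-mapCoefficients R S T φ χ (x ∷ xs) p = ≡.trans
  (foldr-map _ _ _ p)
  (foldr-cong (λ a v → ≡.cong (_+ x * v) (evaluate-mapCoefficients R S T φ χ xs a)) ≡.refl p)
  where open RawRing T

-- Evaluation as a homomorphism.

module _ (S : CommutativeRing c ℓ) where
  private module S = CommutativeRing S
  open CommutativeRing S hiding (rawRing)
  open SetoidReasoning setoid
  open CommutativeSemigroupProperties +-commutativeSemigroup using (interchange)
  open CommutativeSemigroupProperties *-commutativeSemigroup using (x∙yz≈y∙xz)

  -- The source is a raw ring, so an iterated polynomial ring can be the source without a proof of
  -- its ring laws; every law used is one of the target `S`.
  IsHomomorphism : (K : RawRing c₁ ℓ₁) → (RawRing.Carrier K → Carrier) → Set _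
  IsHomomorphism K = IsNearSemiringHomomorphism
    where
    open RawSemiring using (rawNearSemiring)
    open NearSemiringMorphisms (rawNearSemiring (RawRing.rawSemiring K))
                               (rawNearSemiring (RawRing.rawSemiring S.rawRing))

  coeff-map : (K : RawRing c₁ ℓ₁) (h : RawRing.Carrier K → Carrier) → h (RawRing.0# K) ≈ 0# →
              ∀ p i → coeff S.rawRing (map h p) i ≈ h (coeff K p i)
  coeff-map K h h0≈0 []      i       = sym h0≈0
  coeff-map K h h0≈0 (a ∷ p) zero    = refl
  coeff-map K h h0≈0 (a ∷ p) (suc i) = coeff-map K h h0≈0 p i

  module _ (K : RawRing c₁ ℓ₁) (h : RawRing.Carrier K → Carrier)
           (h-homo : IsHomomorphism K h) (x : Carrier) where
    private
      module K = RawRing K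
      open NearSemiringMorphisms.IsNearSemiringHomomorphism h-homo

    -- When `h` is evaluation at `xs`, this unfolds to evaluation at `x ∷ xs`, so results on
    -- `horner` are induction steps on the number of variables.
    horner : List K.Carrier → Carrier
    horner = foldr (λ a v → h a + x * v) 0#

    0+x*0≈0 : ∀ {a v} → a ≈ 0# → v ≈ 0# → a + x * v ≈ 0#
    0+x*0≈0 {a} {v} a≈0 v≈0 = begin
      a + x * v   ≈⟨ +-cong a≈0 (*-congˡ v≈0) ⟩
      0# + x * 0# ≈⟨ +-identityˡ _ ⟩
      x * 0#      ≈⟨ zeroʳ x ⟩
      0#          ∎

    horner-zero : ∀ p → (∀ i → h (coeff K p i) ≈ 0#) → horner p ≈ 0#
    horner-zero []      p≈0 = refl
    horner-zero (a ∷ p) p≈0 = 0+x*0≈0 (p≈0 0) (horner-zero p (p≈0 ∘ suc))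

    -- Equal polynomials may be lists of different lengths; the surplus entries are equal to zero
    -- and contribute nothing, by `horner-zero`.
    horner-cong : ∀ p q → (∀ i → coeff K p i K.≈ coeff K q i) → horner p ≈ horner q
    horner-cong []      q       p≈q =
      sym (horner-zero q (λ i → trans (sym (⟦⟧-cong (p≈q i))) 0#-homo))
    horner-cong (a ∷ p) []      p≈q =
      horner-zero (a ∷ p) (λ i → trans (⟦⟧-cong (p≈q i)) 0#-homo)
    horner-cong (a ∷ p) (b ∷ q) p≈q =
      +-cong (⟦⟧-cong (p≈q 0)) (*-congˡ (horner-cong p q (p≈q ∘ suc)))

    horner-+ : ∀ p q → horner (addCoeffs K p q) ≈ horner p + horner q
    horner-+ []      q       = sym (+-identityˡ _)
    horner-+ (a ∷ p) []      = sym (+-identityʳ _)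
    horner-+ (a ∷ p) (b ∷ q) = begin
      h (a K.+ b) + x * horner (addCoeffs K p q)    ≈⟨ +-cong (+-homo a b) (*-congˡ (horner-+ p q)) ⟩
      (h a + h b) + x * (horner p + horner q)       ≈⟨ +-congˡ (distribˡ x _ _) ⟩
      (h a + h b) + (x * horner p + x * horner q)   ≈⟨ interchange _ _ _ _ ⟩
      (h a + x * horner p) + (h b + x * horner q)   ∎

    horner-scale : ∀ a q → horner (map (a K.*_) q) ≈ h a * horner q
    horner-scale a []      = sym (zeroʳ _)
    horner-scale a (b ∷ q) = begin
      h (a K.* b) + x * horner (map (a K.*_) q) ≈⟨ +-cong (*-homo a b) (*-congˡ (horner-scale a q)) ⟩
      h a * h b + x * (h a * horner q)          ≈⟨ +-congˡ (x∙yz≈y∙xz x _ _) ⟩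
      h a * h b + h a * (x * horner q)          ≈⟨ distribˡ _ _ _ ⟨
      h a * (h b + x * horner q)                ∎

    horner-* : ∀ p q → horner (mulCoeffs K p q) ≈ horner p * horner q
    horner-* []      q = sym (zeroˡ _)
    horner-* (a ∷ p) q = begin
      horner (addCoeffs K (map (a K.*_) q) (K.0# ∷ mulCoeffs K p q))
        ≈⟨ horner-+ (map (a K.*_) q) _ ⟩
      horner (map (a K.*_) q) + (h K.0# + x * horner (mulCoeffs K p q))
        ≈⟨ +-cong (horner-scale a q) (+-cong 0#-homo (*-congˡ (horner-* p q))) ⟩
      h a * horner q + (0# + x * (horner p * horner q))
        ≈⟨ +-congˡ (+-identityˡ _) ⟩
      h a * horner q + x * (horner p * horner q)
        ≈⟨ +-congˡ (*-assoc x _ _) ⟨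
      h a * horner q + x * horner p * horner q
        ≈⟨ distribʳ _ _ _ ⟨
      (h a + x * horner p) * horner q
        ∎

    horner-isHomomorphism : IsHomomorphism (K [X]) horner
    horner-isHomomorphism = record
      { +-isMonoidHomomorphism = record
        { isMagmaHomomorphism = record
          { isRelHomomorphism = record { cong = λ {p} {q} → horner-cong p q }
          ; homo = horner-+
          }
        ; ε-homo = refl
        }
      ; *-homo = horner-*
      }

  private
    eval : {n : ℕ} → Vec Carrier n → Polynomial S.rawRing n → Carrier
    eval = evaluate S.rawRing S.rawRing id

  evaluate-isHomomorphism : {n : ℕ} (xs : Vec Carrier n) →
                            IsHomomorphism (S.rawRing [X^ n ]) (eval xs)
  evaluate-isHomomorphism []       = Identity.isNearSemiringHomomorphism _ refl
  evaluate-isHomomorphism (x ∷ xs) =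
    horner-isHomomorphism _ (eval xs) (evaluate-isHomomorphism xs) x

  evaluate-constant : {n : ℕ} (xs : Vec Carrier n) (a : Carrier) →
                      eval xs (constant S.rawRing n a) ≈ a
  evaluate-constant         []       a = refl
  evaluate-constant {suc n} (x ∷ xs) a = begin
    eval xs (constant S.rawRing n a) + x * 0# ≈⟨ +-cong (evaluate-constant xs a) (zeroʳ x) ⟩
    a + 0#                                    ≈⟨ +-identityʳ a ⟩
    a                                         ∎

  evaluate-congˡ : {n : ℕ} {xs ys : Vec Carrier n} → Pointwise _≈_ xs ys →
                   ∀ p → eval xs p ≈ eval ys p
  evaluate-congˡ []            p       = refl
  evaluate-congˡ (x≈y ∷ xs≈ys) []      = refl
  evaluate-congˡ (x≈y ∷ xs≈ys) (a ∷ p) =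
    +-cong (evaluate-congˡ xs≈ys a) (*-cong x≈y (evaluate-congˡ (x≈y ∷ xs≈ys) p))

  evaluate-origin : (n : ℕ) (p : Polynomial S.rawRing n) →
                    eval (Vec.replicate n 0#) p ≈ constantTerm S.rawRing n p
  evaluate-origin zero    p       = refl
  -- The constant term of the empty list unfolds to that of the zero of the ring in `n` variables,
  -- so the induction hypothesis is applied to this zero.
  evaluate-origin (suc n) []      = trans
    (sym (NearSemiringMorphisms.IsNearSemiringHomomorphism.0#-homo
           (evaluate-isHomomorphism (Vec.replicate n 0#))))
    (evaluate-origin n (RawRing.0# (S.rawRing [X^ n ])))
  evaluate-origin (suc n) (a ∷ p) = begin
    eval (Vec.replicate n 0#) a + 0# * _ ≈⟨ +-cong (evaluate-origin n a) (zeroˡ _) ⟩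
    constantTerm S.rawRing n a + 0#        ≈⟨ +-identityʳ _ ⟩
    constantTerm S.rawRing n a             ∎

  -- Each Horner step is a sum and a product, so `h` passes through it. Taking evaluation at x for
  -- `h` moves x inside Q(f₁,...,fₘ).
  homomorphism-evaluate :
    (R : RawRing c₁ ℓ₁) (K : RawRing c₂ ℓ₂)
    (φ : RawRing.Carrier R → RawRing.Carrier K) (ψ : RawRing.Carrier R → Carrier)
    (h : RawRing.Carrier K → Carrier) → IsHomomorphism K h → (∀ a → h (φ a) ≈ ψ a) →
    {m : ℕ} (gs : Vec (RawRing.Carrier K) m) (p : Polynomial R m) →
    h (evaluate R K φ gs p) ≈ evaluate R S.rawRing ψ (Vec.map h gs) p
  homomorphism-evaluate R K φ ψ h h-homo hφ≈ψ = go
    where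
    open NearSemiringMorphisms.IsNearSemiringHomomorphism h-homo
    go : {m : ℕ} (gs : Vec (RawRing.Carrier K) m) (p : Polynomial R m) →
         h (evaluate R K φ gs p) ≈ evaluate R S.rawRing ψ (Vec.map h gs) p
    go []       a       = hφ≈ψ a
    go (g ∷ gs) []      = 0#-homo
    go (g ∷ gs) (a ∷ p) = begin
      h (evaluate R K φ gs a K.+ g K.* v)    ≈⟨ +-homo _ _ ⟩
      h (evaluate R K φ gs a) + h (g K.* v)  ≈⟨ +-cong (go gs a) (*-homo g v) ⟩
      evaluate R S.rawRing ψ (Vec.map h gs) a + h g * h v
        ≈⟨ +-congˡ (*-congˡ (go (g ∷ gs) p)) ⟩
      evaluate R S.rawRing ψ (Vec.map h (g ∷ gs)) (a ∷ p) ∎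
      where
      module K = RawRing K
      v = evaluate R K φ (g ∷ gs) p

-- Polynomials vanishing everywhere over an algebraically closed field.

module _ (A : HeytingField c ℓ₁ ℓ₂) (closed : IsAlgebraicallyClosed A) where
  open HeytingField A
  open AffineSpace A
  open SetoidReasoning setoid

  vanishing₁⇒coeff≈0 : (p : Polynomial (rawRing A) 1) → (∀ x → value p (x ∷ []) ≈ 0#) →
                       ∀ i → coeff (rawRing A) p i ≈ 0#
  vanishing₁⇒coeff≈0 []      p≈0 i       = refl
  vanishing₁⇒coeff≈0 (a ∷ p) p≈0 zero    = begin
    a                              ≈⟨ +-identityʳ a ⟨
    a + 0#                         ≈⟨ +-congˡ (zeroˡ _) ⟨
    a + 0# * value p (0# ∷ [])     ≈⟨ p≈0 0# ⟩
    0#                             ∎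
  -- By tightness it suffices to refute apartness from zero. Adding 1 changes only the constant
  -- coefficient, so entry `i` of the tail still witnesses that the sum is nonconstant.
  vanishing₁⇒coeff≈0 (a ∷ p) p≈0 (suc i) = proj₁ (tight _ _) λ pᵢ#0 →
    let x , root = closed ((1# + a) ∷ p) (i , pᵢ#0)
        v        = value p (x ∷ [])
        1≈0 = begin
          1#                   ≈⟨ +-identityʳ 1# ⟨
          1# + 0#              ≈⟨ +-congˡ (p≈0 x) ⟨
          1# + (a + x * v)     ≈⟨ +-assoc 1# a _ ⟨
          (1# + a) + x * v     ≈⟨ root ⟩
          0#                   ∎
        -- With 1 ≈ 0 every element is zero, including the coefficient assumed apart from it.
        pᵢ≈0 = begin
          coeff (rawRing A) p i       ≈⟨ *-identityˡ _ ⟨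
          1# * coeff (rawRing A) p i  ≈⟨ *-congʳ 1≈0 ⟩
          0# * coeff (rawRing A) p i  ≈⟨ zeroˡ _ ⟩
          0#                          ∎
    in #-irrefl pᵢ≈0 pᵢ#0

  -- Fixing all variables but the outermost leaves a one-variable polynomial that vanishes
  -- everywhere, so its coefficients are zero. These are the values at `xs` of the coefficients of
  -- `p`, to which induction applies as `xs` varies.
  vanishing⇒≈0 : (n : ℕ) (p : Polynomial (rawRing A) n) → (∀ xs → value {n} p xs ≈ 0#) →
                 let open RawRing (rawRing A [X^ n ]) renaming (_≈_ to _≈ₙ_; 0# to 0ₙ) in p ≈ₙ 0ₙ
  vanishing⇒≈0 zero    a p≈0   = p≈0 []
  vanishing⇒≈0 (suc n) p p≈0 i = vanishing⇒≈0 n (coeff A[X^n] p i) λ xs →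
    let at-xs : Polynomial (rawRing A) n → Carrier
        at-xs a = value {n} a xs
        open NearSemiringMorphisms.IsNearSemiringHomomorphism
          (evaluate-isHomomorphism (commutativeRing A) xs) using (0#-homo)
    in begin
      at-xs (coeff A[X^n] p i)
        ≈⟨ coeff-map (commutativeRing A) A[X^n] at-xs 0#-homo p i ⟨
      coeff (rawRing A) (map at-xs p) i
        ≈⟨ vanishing₁⇒coeff≈0 (map at-xs p)
             (λ x → trans (reflexive (foldr-map (λ a v → a + x * v) at-xs 0# p)) (p≈0 (x ∷ xs))) i ⟩
      0#
        ∎
    where A[X^n] = rawRing A [X^ n ]

-- Annihilators and vanishing on the image.

module _ {c₁ ℓ₁ ℓ₂ c₂ ℓ₃ ℓ₄ : Level}
         (F : HeytingField c₁ ℓ₁ ℓ₂) (A : HeytingField c₂ ℓ₃ ℓ₄)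
         (ι : HeytingField.Carrier F → HeytingField.Carrier A)
         (closed : IsAlgebraicallyClosed A)
         (n m : ℕ) (f : Vec (Polynomial (rawRing F) n) m) where
  open HeytingField A
  open AffineSpace A
  open PolynomialMap F A ι n m f
  open SetoidReasoning setoid

  private
    fᴬ : Vec (Polynomial (rawRing A) n) m
    fᴬ = Vec.map (mapCoefficients (rawRing F) (rawRing A) ι n) f

    substituted : Polynomial (rawRing A) m → Polynomial (rawRing A) n
    substituted = evaluate (rawRing A) (rawRing A [X^ n ]) (constant (rawRing A) n) fᴬ

  value-substituted : ∀ Q x → value {n} (substituted Q) x ≈ value Q (polynomialMap x)
  value-substituted Q x = begin
    value {n} (substituted Q) x
      ≈⟨ homomorphism-evaluate (commutativeRing A) (rawRing A) (rawRing A [X^ n ]) _ id _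
           (evaluate-isHomomorphism (commutativeRing A) x)
           (evaluate-constant (commutativeRing A) x) fᴬ Q ⟩
    value Q (Vec.map (λ p → value {n} p x) fᴬ)
      ≡⟨ ≡.cong (value Q) (map-∘ _ _ f) ⟨
    value Q (Vec.map (λ p → value {n} (mapCoefficients (rawRing F) (rawRing A) ι n p) x) f)
      ≡⟨ ≡.cong (value Q) (map-cong
           (evaluate-mapCoefficients (rawRing F) (rawRing A) (rawRing A) ι id x) f) ⟩
    value Q (polynomialMap x)
      ∎

  -- A preimage x of y turns Q(y) into the value of Q(f₁,...,fₘ) at x, and evaluation respects
  -- coefficientwise equality with zero.
  annihilator⇒vanishing : ∀ Q → IsAnnihilator Q → ∀ {y} → y ∈ Image → value Q y ≈ 0#
  annihilator⇒vanishing Q Q[f]≈0 {y} (x , fx≈y) = begin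
    value Q y                 ≈⟨ evaluate-congˡ (commutativeRing A) fx≈y Q ⟨
    value Q (polynomialMap x) ≈⟨ value-substituted Q x ⟨
    value {n} (substituted Q) x   ≈⟨ ⟦⟧-cong Q[f]≈0 ⟩
    value (RawRing.0# (rawRing A [X^ n ])) x ≈⟨ 0#-homo ⟩
    0#                        ∎
    where
    open NearSemiringMorphisms.IsNearSemiringHomomorphism
      (evaluate-isHomomorphism (commutativeRing A) x)

  -- Algebraic closedness enters here, in passing from the values of Q(f₁,...,fₘ) to its
  -- coefficients.
  vanishing⇒annihilator : ∀ Q → (∀ x → value Q (polynomialMap x) ≈ 0#) → IsAnnihilator Q
  vanishing⇒annihilator Q Q≈0 =
    vanishing⇒≈0 A closed n (substituted Q) (λ x → trans (value-substituted Q x) (Q≈0 x))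

-- Constant terms and the closure of the image.

lemma13 : {c₁ ℓ₁ ℓ₂ c₂ ℓ₃ ℓ₄ : Level}
    (F : HeytingField c₁ ℓ₁ ℓ₂) (A : HeytingField c₂ ℓ₃ ℓ₄)
    (ι : HeytingField.Carrier F → HeytingField.Carrier A) →
    IsAlgebraicClosure F A ι →
    (n m : ℕ) (f : Vec (Polynomial (rawRing F) n) m) →
    let open HeytingField A using (_≈_)
        open AffineSpace A
        open PolynomialMap F A ι n m f
    in (∀ (Q : Polynomial (rawRing A) m) → IsAnnihilator Q →
          constantTerm (rawRing A) m Q ≈ HeytingField.0# A)
       ⇔ (origin m ∈ ZariskiClosure Image)
lemma13 {c₂ = c₂} {ℓ₃ = ℓ₃} F A ι closure n m f = mk⇔ to from
  where
  open HeytingField A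
  open AffineSpace A
  open PolynomialMap F A ι n m f
  closed = IsAlgebraicClosure.isAlgebraicallyClosed closure

  value-origin : ∀ Q → value Q (origin m) ≈ constantTerm (rawRing A) m Q
  value-origin = evaluate-origin (commutativeRing A) m

  to : (∀ Q → IsAnnihilator Q → constantTerm (rawRing A) m Q ≈ 0#) →
       origin m ∈ ZariskiClosure Image
  -- Every equation Q of a closed set containing Im(f) vanishes at each f(x), hence is an
  -- annihilator, and so vanishes at O.
  to Q₀≈0 Z (I , Z⊆V , V⊆Z) Im⊆Z = V⊆Z λ Q Q∈I → trans (value-origin Q)
    (Q₀≈0 Q (vanishing⇒annihilator F A ι closed n m f Q
      (λ x → Z⊆V (Im⊆Z (x , Pointwise.refl refl)) Q Q∈I)))

  from : origin m ∈ ZariskiClosure Image →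
         ∀ Q → IsAnnihilator Q → constantTerm (rawRing A) m Q ≈ 0#
  from O∈closure Q Q[f]≈0 = trans (sym (value-origin Q))
    (O∈closure (VanishingSet only-Q) (only-Q , id , id)
      (λ { y∈Im _ (lift ≡.refl) → annihilator⇒vanishing F A ι closed n m f Q Q[f]≈0 y∈Im })
      Q (lift ≡.refl))
    where
    -- The singleton of Q, lifted to the universe level that `IsZariskiClosed` fixes for systems of
    -- equations.
    only-Q : Pred (Polynomial (rawRing A) m) (c₂ ⊔ ℓ₃)
    only-Q P = Lift ℓ₃ (P ≡ Q)
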